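{- Let $b,c$ be positive integers with $\gcd(b,c)=1$ and $b+c=4^l$ for a positive integer $l$. Then for all nonnegative integers $m,n$ with $2m+n=\frac{4^l-1}{3}$ there is a perfect coloring of $D(m,n)$ with quotient matrix $\begin{pmatrix} c-1 & b\\ c & b-1\end{pmatrix}$.
   Context: The Shrikhande graph is the Cayley graph on $\mathbb{Z}_4^2$ with connection set $\{01,03,10,30,11,33\}$. For nonnegative integers $m,n$, $D(m,n)$ is the Cartesian product of $m$ copies of the Shrikhande graph and $n$ copies of $K_4$ (vertex set $(\mathbb{Z}_4^2)^m\times\mathbb{Z}_4^n$; adjacent iff differing in exactly one coordinate by an adjacency of that factor). A $2$-coloring (surjective map onto colors $\{1,2\}$) is perfect with quotient matrix $(s_{ij})$ if every vertex of color $i$ has exactly $s_{ij}$ neighbours of color $j$. -}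

module Defs where

open import Data.Nat using (ℕ; zero; suc; _+_; _%_)
open import Data.Fin using (Fin; toℕ)
import Data.Fin as F
open import Data.Bool using (Bool; true; false; _∧_; _∨_)
open import Data.List using (List; []; _∷_; length; filterᵇ; concatMap; map; allFin)
open import Data.Bool.ListAction using (any)
open import Data.Vec using (Vec; []; _∷_)
open import Data.Product using (_×_; _,_)
open import Relation.Nullary.Decidable using (⌊_⌋)
open import Data.Nat using (_≡ᵇ_)

ℤ₄ : Set
ℤ₄ = Fin 4

diff4 : ℤ₄ → ℤ₄ → ℕ
diff4 x y = (toℕ y + (4 Data.Nat.∸ toℕ x)) % 4

eqℤ₄ : ℤ₄ → ℤ₄ → Bool
eqℤ₄ x y = ⌊ x F.≟ y ⌋

adjK4 : ℤ₄ → ℤ₄ → Bool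
adjK4 x y = Data.Bool.not (eqℤ₄ x y)

-- Shrikhande graph: Cayley graph on ℤ₄² with connection set {01,03,10,30,11,33}
shrConn : List (ℕ × ℕ)
shrConn = (0 , 1) ∷ (0 , 3) ∷ (1 , 0) ∷ (3 , 0) ∷ (1 , 1) ∷ (3 , 3) ∷ []

adjShr : ℤ₄ × ℤ₄ → ℤ₄ × ℤ₄ → Bool
adjShr (x₁ , x₂) (y₁ , y₂) =
  any (λ { (a , b) → (diff4 x₁ y₁ ≡ᵇ a) ∧ (diff4 x₂ y₂ ≡ᵇ b) }) shrConn

eqPair : ℤ₄ × ℤ₄ → ℤ₄ × ℤ₄ → Bool
eqPair (x₁ , x₂) (y₁ , y₂) = eqℤ₄ x₁ y₁ ∧ eqℤ₄ x₂ y₂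

eqVec : {A : Set} → (A → A → Bool) → {k : ℕ} → Vec A k → Vec A k → Bool
eqVec eq [] [] = true
eqVec eq (x ∷ xs) (y ∷ ys) = eq x y ∧ eqVec eq xs ys

adjVec : {A : Set} → (A → A → Bool) → (A → A → Bool) →
         {k : ℕ} → Vec A k → Vec A k → Bool
adjVec eq adj [] [] = false
adjVec eq adj (x ∷ xs) (y ∷ ys) =
  (adj x y ∧ eqVec eq xs ys) ∨ (eq x y ∧ adjVec eq adj xs ys)

Vertex : ℕ → ℕ → Set
Vertex m n = Vec (ℤ₄ × ℤ₄) m × Vec ℤ₄ n

adjD : {m n : ℕ} → Vertex m n → Vertex m n → Bool
adjD (u₁ , u₂) (v₁ , v₂) =
  (adjVec eqPair adjShr u₁ v₁ ∧ eqVec eqℤ₄ u₂ v₂) ∨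
  (eqVec eqPair u₁ v₁ ∧ adjVec eqℤ₄ adjK4 u₂ v₂)

allVecs : {A : Set} → List A → (k : ℕ) → List (Vec A k)
allVecs xs zero = [] ∷ []
allVecs xs (suc k) = concatMap (λ x → map (x ∷_) (allVecs xs k)) xs

allℤ₄² : List (ℤ₄ × ℤ₄)
allℤ₄² = concatMap (λ x → map (x ,_) (allFin 4)) (allFin 4)

allVertices : (m n : ℕ) → List (Vertex m n)
allVertices m n =
  concatMap (λ u → map (u ,_) (allVecs (allFin 4) n)) (allVecs allℤ₄² m)

-- Colors: Fin 2 (zero = color 1, suc zero = color 2)
-- number of neighbours of v having color j under the coloring col
nbrsOfColor : {m n : ℕ} → (Vertex m n → Fin 2) → Vertex m n → Fin 2 → ℕ
nbrsOfColor {m} {n} col v j =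
  length (filterᵇ (λ w → adjD v w ∧ eqFin2 (col w) j) (allVertices m n))
  where
  eqFin2 : Fin 2 → Fin 2 → Bool
  eqFin2 a b = ⌊ a F.≟ b ⌋

{-# OPTIONS --safe #-}

-- It suffices to map the vertices onto a set of 4 ^ l labels so that every closed
-- ball is mapped bijectively: the vertices whose label lies in a fixed set of b
-- labels then form colour 2.  Such maps are built as in the recursive construction
-- of Hamming codes, with
-- (4 ^ (l + 1) ∸ 1) / 3 = 4 k + 1 for k = (4 ^ l ∸ 1) / 3.  One K₄ coordinate x is
-- set aside and the remaining factors are grouped into k blocks, each of the form
-- D(2,0), D(1,2) or D(0,4).  A vertex of a block gets a pair (p , q) ∈ ℤ₄ × ℤ₄ such
-- that its 12 neighbours run once over the pairs whose first entry differs from p.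
-- If H is such a map for K₄ᵏ = D(0,k) with 4 ^ l labels, then
-- (H (p₁ , … , pₖ) , q₁ ⊕ ⋯ ⊕ qₖ ⊕ x) is one for D(m,n) with 4 ^ (l + 1) labels.
-- Bijectivity on neighbourhoods is expressed by comparing sums of an arbitrary
-- weight g.
module Submission where

open import Defs
open import Data.Bool using (Bool; true; false; if_then_else_; _∧_; _∨_)
import Data.Bool.Properties as Bool
open import Data.Bool.Properties using (if-∧)
open import Data.Fin using (Fin; zero; suc; toℕ)
open import Data.Fin.Patterns using (0F; 1F; 2F; 3F)
import Data.Fin.Properties as Fin
open import Data.List using (List; []; _∷_; _++_; map; concatMap; filterᵇ; length; allFin)
open import Data.List.Membership.Propositional.Properties using (∈-∃++)
open import Data.List.Properties using (map-cong; map-∘; map-++; map-tabulate)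
open import Data.List.Relation.Binary.Permutation.Propositional
  using (_↭_; ↭-refl; ↭-sym; ↭-trans; prep)
import Data.List.Relation.Binary.Permutation.Propositional.Properties as ↭
open import Data.List.Relation.Unary.Any using (here; any?)
open import Data.Nat using (ℕ; zero; suc; _+_; _*_; _∸_; _^_; _≥_; _/_; _%_)
open import Data.Nat.DivMod using (_mod_; m*n/n≡m)
open import Data.Nat.GCD using (gcd)
open import Data.Nat.ListAction using (sum)
open import Data.Nat.ListAction.Properties using (sum-++; sum-↭)
open import Data.Nat.Properties
  using (+-identityʳ; +-assoc; +-suc; +-cancelˡ-≡; *-comm; suc-injective; even≢odd;
         ≤-total; ≤-trans; ≤-reflexive; m+[n∸m]≡n; m+n∸m≡n)
open import Data.Nat.Tactic.RingSolver using (solve-∀)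
open import Data.Product using (Σ; ∃; _×_; _,_; proj₁; proj₂)
open import Data.Product.Properties using (≡-dec)
open import Data.Sum using (inj₁; inj₂)
open import Data.Vec as Vec using (Vec; []; _∷_)
import Data.Vec.Properties as Vec
open import Function using (_∘_; case_of_)
open import Relation.Binary.Definitions using (Decidable; DecidableEquality)
open import Relation.Binary.PropositionalEquality
  using (_≡_; _≗_; refl; sym; trans; cong; cong₂; subst; module ≡-Reasoning)
open import Relation.Nullary using (Dec; yes; no; contradiction)
open import Relation.Nullary.Decidable using (⌊_⌋; map′; from-yes)

open ≡-Reasoning

private
  variable
    A B C : Set
    k l m n k′ m′ n′ M : ℕ

-- Weighted sums over finite lists.

∑ : List A → (A → ℕ) → ℕ
∑ xs g = sum (map g xs)

infixr 6.5 ∑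
syntax ∑ xs (λ x → e) = ∑[ x ∈ xs ] e

infixr 6.5 [_]·_

-- The Iverson bracket times a weight. As an `if`, it turns a conjunction of tests into nested
-- brackets by `if-∧`.
[_]·_ : Bool → ℕ → ℕ
[ b ]· w = if b then w else 0

∑-cong : {g h : A → ℕ} → g ≗ h → (xs : List A) → ∑ xs g ≡ ∑ xs h
∑-cong g≗h xs = cong sum (map-cong g≗h xs)

∑-++ : (xs ys : List A) (g : A → ℕ) → ∑ (xs ++ ys) g ≡ ∑ xs g + ∑ ys g
∑-++ xs ys g = trans (cong sum (map-++ g xs ys)) (sum-++ (map g xs) (map g ys))

∑-map : (f : A → B) (xs : List A) (g : B → ℕ) → ∑ (map f xs) g ≡ ∑ xs (g ∘ f)
∑-map f xs g = cong sum (sym (map-∘ xs))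

∑-↭ : {xs ys : List A} → xs ↭ ys → (g : A → ℕ) → ∑ xs g ≡ ∑ ys g
∑-↭ p g = sum-↭ (↭.map⁺ g p)

∑-grid : (f : A → B → C) (xs : List A) (ys : List B) (g : C → ℕ) →
  ∑ (concatMap (λ x → map (f x) ys) xs) g ≡ ∑[ x ∈ xs ] ∑[ y ∈ ys ] g (f x y)
∑-grid f []       ys g = refl
∑-grid f (x ∷ xs) ys g =
  trans (∑-++ (map (f x) ys) _ g) (cong₂ _+_ (∑-map (f x) ys g) (∑-grid f xs ys g))

interchange : ∀ a b c d → a + b + (c + d) ≡ a + c + (b + d)
interchange = solve-∀

∑-+ : (xs : List A) (g h : A → ℕ) → ∑[ x ∈ xs ] (g x + h x) ≡ ∑ xs g + ∑ xs h
∑-+ []       g h = refl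
∑-+ (x ∷ xs) g h rewrite ∑-+ xs g h = interchange (g x) (h x) (∑ xs g) (∑ xs h)

∑-zero : (xs : List A) → ∑[ _ ∈ xs ] 0 ≡ 0
∑-zero []       = refl
∑-zero (_ ∷ xs) = ∑-zero xs

∑-swap : (xs : List A) (ys : List B) (g : A → B → ℕ) →
  ∑[ x ∈ xs ] ∑[ y ∈ ys ] g x y ≡ ∑[ y ∈ ys ] ∑[ x ∈ xs ] g x y
∑-swap []       ys g = sym (∑-zero ys)
∑-swap (x ∷ xs) ys g = trans (cong (∑ ys (g x) +_) (∑-swap xs ys g)) (sym (∑-+ ys _ _))

∑-guard : ∀ b (xs : List A) (g : A → ℕ) → ∑[ x ∈ xs ] [ b ]· g x ≡ [ b ]· ∑ xs g
∑-guard true  xs g = refl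
∑-guard false xs g = ∑-zero xs

∑-filter : (p : A → Bool) (xs : List A) (g : A → ℕ) →
  ∑ (filterᵇ p xs) g ≡ ∑[ x ∈ xs ] [ p x ]· g x
∑-filter p []       g = refl
∑-filter p (x ∷ xs) g with p x
... | true  = cong (g x +_) (∑-filter p xs g)
... | false = ∑-filter p xs g

length-∑ : (xs : List A) → length xs ≡ ∑[ _ ∈ xs ] 1
length-∑ []       = refl
length-∑ (_ ∷ xs) = cong suc (length-∑ xs)

length-filter : (p : A → Bool) (xs : List A) → length (filterᵇ p xs) ≡ ∑[ x ∈ xs ] [ p x ]· 1
length-filter p xs = trans (length-∑ (filterᵇ p xs)) (∑-filter p xs _)

filter-witness : (p : A → Bool) (xs : List A) → length (filterᵇ p xs) ≥ 1 → ∃ λ x → p x ≡ true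
filter-witness p (x ∷ xs) 1≤ with p x in eq
... | true  = x , eq
... | false = filter-witness p xs 1≤

-- Finite graphs and neighbourhood sums in Cartesian products.

record FinGraph (A : Set) : Set where
  field
    vertices    : List A
    eq adj      : A → A → Bool
    nbrs        : A → List A
    -- For all `g` together: `x` is listed exactly once, and `eq x` holds of no other listed vertex.
    sift        : ∀ x (g : A → ℕ) → ∑[ y ∈ vertices ] [ eq x y ]· g y ≡ g x
    ∑-adj       : ∀ x (g : A → ℕ) → ∑[ y ∈ vertices ] [ adj x y ]· g y ≡ ∑ (nbrs x) g
    irreflexive : ∀ x y → adj x y ∧ eq x y ≡ false

open FinGraph

module Product (G : FinGraph A) (H : FinGraph B) where

  sift-× : ∀ x y (g : A → B → ℕ) →
    ∑[ a ∈ vertices G ] ∑[ b ∈ vertices H ] [ eq G x a ∧ eq H y b ]· g a b ≡ g x y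
  sift-× x y g = begin
    ∑[ a ∈ vertices G ] ∑[ b ∈ vertices H ] [ eq G x a ∧ eq H y b ]· g a b
      ≡⟨ ∑-cong (λ a → ∑-cong (λ b → if-∧ (eq G x a)) (vertices H)) (vertices G) ⟩
    ∑[ a ∈ vertices G ] ∑[ b ∈ vertices H ] [ eq G x a ]· [ eq H y b ]· g a b
      ≡⟨ ∑-cong (λ a → trans (∑-guard (eq G x a) (vertices H) _)
                             (cong ([ eq G x a ]·_) (sift H y (g a)))) (vertices G) ⟩
    ∑[ a ∈ vertices G ] [ eq G x a ]· g a y
      ≡⟨ sift G x (λ a → g a y) ⟩
    g x y ∎

  private
    adj-× : A → B → A → B → Bool
    adj-× x y a b = (adj G x a ∧ eq H y b) ∨ (eq G x a ∧ adj H y b)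

    -- Since `p` and `r` exclude each other, at most one disjunct holds, so the bracket of the
    -- disjunction splits into a sum.
    distinguish : ∀ p q r s w → p ∧ r ≡ false →
      [ (p ∧ q) ∨ (r ∧ s) ]· w ≡ [ p ]· [ q ]· w + [ r ]· [ s ]· w
    distinguish true  true  false s w _ = sym (+-identityʳ w)
    distinguish true  false false s w _ = refl
    distinguish false q     true  s w _ = refl
    distinguish false q     false s w _ = refl

    ∑-adj-row : ∀ x y (g : A → B → ℕ) a →
      ∑[ b ∈ vertices H ] [ adj-× x y a b ]· g a b
        ≡ [ adj G x a ]· g a y + [ eq G x a ]· ∑[ b ∈ nbrs H y ] g a b
    ∑-adj-row x y g a = begin
      ∑[ b ∈ vertices H ] [ adj-× x y a b ]· g a b
        ≡⟨ ∑-cong (λ b → distinguish (adj G x a) _ (eq G x a) _ (g a b) (irreflexive G x a)) (vertices H) ⟩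
      ∑[ b ∈ vertices H ] ([ adj G x a ]· [ eq H y b ]· g a b + [ eq G x a ]· [ adj H y b ]· g a b)
        ≡⟨ ∑-+ (vertices H) _ _ ⟩
      ∑[ b ∈ vertices H ] [ adj G x a ]· [ eq H y b ]· g a b +
        ∑[ b ∈ vertices H ] [ eq G x a ]· [ adj H y b ]· g a b
        ≡⟨ cong₂ _+_ (∑-guard (adj G x a) (vertices H) _) (∑-guard (eq G x a) (vertices H) _) ⟩
      [ adj G x a ]· ∑[ b ∈ vertices H ] [ eq H y b ]· g a b +
        [ eq G x a ]· ∑[ b ∈ vertices H ] [ adj H y b ]· g a b
        ≡⟨ cong₂ (λ s t → [ adj G x a ]· s + [ eq G x a ]· t) (sift H y (g a)) (∑-adj H y (g a)) ⟩
      [ adj G x a ]· g a y + [ eq G x a ]· ∑[ b ∈ nbrs H y ] g a b ∎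

  -- A neighbour in a Cartesian product moves in exactly one factor. Iterated sums and a curried `g`
  -- let this serve both the cons of vectors and the pairs in `Vertex`.
  ∑-adj-× : ∀ x y (g : A → B → ℕ) →
    ∑[ a ∈ vertices G ] ∑[ b ∈ vertices H ] [ adj-× x y a b ]· g a b
      ≡ ∑[ a ∈ nbrs G x ] g a y + ∑[ b ∈ nbrs H y ] g x b
  ∑-adj-× x y g = begin
    ∑[ a ∈ vertices G ] ∑[ b ∈ vertices H ] [ adj-× x y a b ]· g a b
      ≡⟨ ∑-cong (∑-adj-row x y g) (vertices G) ⟩
    ∑[ a ∈ vertices G ] ([ adj G x a ]· g a y + [ eq G x a ]· ∑[ b ∈ nbrs H y ] g a b)
      ≡⟨ ∑-+ (vertices G) _ _ ⟩
    ∑[ a ∈ vertices G ] [ adj G x a ]· g a y + ∑[ a ∈ vertices G ] [ eq G x a ]· ∑[ b ∈ nbrs H y ] g a b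
      ≡⟨ cong₂ _+_ (∑-adj G x (λ a → g a y)) (sift G x (λ a → ∑ (nbrs H y) (g a))) ⟩
    ∑[ a ∈ nbrs G x ] g a y + ∑[ b ∈ nbrs H y ] g x b ∎

open Product

nbrsVec : (A → List A) → Vec A k → List (Vec A k)
nbrsVec nb []       = []
nbrsVec nb (x ∷ xs) = map (_∷ xs) (nb x) ++ map (x ∷_) (nbrsVec nb xs)

∑-nbrsVec-∷ : (nb : A → List A) (x : A) (xs : Vec A k) (g : Vec A (suc k) → ℕ) →
  ∑ (nbrsVec nb (x ∷ xs)) g ≡ ∑[ y ∈ nb x ] g (y ∷ xs) + ∑[ ys ∈ nbrsVec nb xs ] g (x ∷ ys)
∑-nbrsVec-∷ nb x xs g = trans (∑-++ (map (_∷ xs) (nb x)) _ g)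
  (cong₂ _+_ (∑-map (_∷ xs) (nb x) g) (∑-map (x ∷_) (nbrsVec nb xs) g))

∑-nbrsVec-++ : (nb : A → List A) (xs : Vec A k) (ys : Vec A k′) (g : Vec A (k + k′) → ℕ) →
  ∑ (nbrsVec nb (xs Vec.++ ys)) g
    ≡ ∑[ xs′ ∈ nbrsVec nb xs ] g (xs′ Vec.++ ys) + ∑[ ys′ ∈ nbrsVec nb ys ] g (xs Vec.++ ys′)
∑-nbrsVec-++ nb []       ys g = refl
∑-nbrsVec-++ nb (x ∷ xs) ys g = begin
  ∑ (nbrsVec nb (x ∷ xs Vec.++ ys)) g
    ≡⟨ ∑-nbrsVec-∷ nb x (xs Vec.++ ys) g ⟩
  ∑[ y ∈ nb x ] g (y ∷ xs Vec.++ ys) + ∑[ zs ∈ nbrsVec nb (xs Vec.++ ys) ] g (x ∷ zs)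
    ≡⟨ cong (∑ (nb x) _ +_) (∑-nbrsVec-++ nb xs ys (g ∘ (x ∷_))) ⟩
  ∑[ y ∈ nb x ] g (y ∷ xs Vec.++ ys) +
    (∑[ xs′ ∈ nbrsVec nb xs ] g (x ∷ xs′ Vec.++ ys) + right)
    ≡⟨ +-assoc (∑ (nb x) _) _ right ⟨
  ∑[ y ∈ nb x ] g (y ∷ xs Vec.++ ys) + ∑[ xs′ ∈ nbrsVec nb xs ] g (x ∷ xs′ Vec.++ ys) + right
    ≡⟨ cong (_+ right) (∑-nbrsVec-∷ nb x xs (g ∘ (Vec._++ ys))) ⟨
  ∑[ xs′ ∈ nbrsVec nb (x ∷ xs) ] g (xs′ Vec.++ ys) + right ∎
  where
  right : ℕ
  right = ∑[ ys′ ∈ nbrsVec nb ys ] g (x ∷ xs Vec.++ ys′)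

vecGraph : FinGraph A → (k : ℕ) → FinGraph (Vec A k)
vecGraph G k .vertices = allVecs (vertices G) k
vecGraph G k .eq       = eqVec (eq G)
vecGraph G k .adj      = adjVec (eq G) (adj G)
vecGraph G k .nbrs     = nbrsVec (nbrs G)
vecGraph G zero    .sift []       g = +-identityʳ (g [])
vecGraph G (suc k) .sift (x ∷ xs) g = trans (∑-grid _∷_ (vertices G) _ _)
  (sift-× G (vecGraph G k) x xs (λ y ys → g (y ∷ ys)))
vecGraph G zero    .∑-adj []       g = refl
vecGraph G (suc k) .∑-adj (x ∷ xs) g = begin
  ∑[ ys ∈ allVecs (vertices G) (suc k) ] [ adjVec (eq G) (adj G) (x ∷ xs) ys ]· g ys
    ≡⟨ ∑-grid _∷_ (vertices G) _ _ ⟩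
  -- On a cons, `adjVec` unfolds to the adjacency of the product of `G` with `vecGraph G k`.
  _
    ≡⟨ ∑-adj-× G (vecGraph G k) x xs (λ y ys → g (y ∷ ys)) ⟩
  ∑[ y ∈ nbrs G x ] g (y ∷ xs) + ∑[ ys ∈ nbrsVec (nbrs G) xs ] g (x ∷ ys)
    ≡⟨ ∑-nbrsVec-∷ (nbrs G) x xs g ⟨
  ∑ (nbrsVec (nbrs G) (x ∷ xs)) g ∎
vecGraph G zero    .irreflexive []       []       = refl
vecGraph G (suc k) .irreflexive (x ∷ xs) (y ∷ ys) =
  exclusive (adj G x y) (eqVec (eq G) xs ys) (eq G x y) (adjVec (eq G) (adj G) xs ys)
    (irreflexive G x y) (irreflexive (vecGraph G k) xs ys)
  where
  -- A true `p` makes `r` false. With `p` false and `r` true, what remains is `s ∧ q`.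
  exclusive : ∀ p q r s → p ∧ r ≡ false → s ∧ q ≡ false → ((p ∧ q) ∨ (r ∧ s)) ∧ (r ∧ q) ≡ false
  exclusive true  true  false s _  _  = refl
  exclusive true  false false s _  _  = refl
  exclusive false q     false s _  _  = refl
  exclusive false q     true  s _  eq = eq

-- Neighbourhoods in K₄, the Shrikhande graph and D(m,n).

K4 : FinGraph ℤ₄
K4 .vertices = allFin 4
K4 .eq       = eqℤ₄
K4 .adj      = adjK4
K4 .nbrs x   = filterᵇ (adjK4 x) (allFin 4)
K4 .sift 0F g = +-identityʳ (g 0F)
K4 .sift 1F g = +-identityʳ (g 1F)
K4 .sift 2F g = +-identityʳ (g 2F)
K4 .sift 3F g = +-identityʳ (g 3F)
K4 .∑-adj x g = sym (∑-filter (adjK4 x) (allFin 4) g)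
K4 .irreflexive = from-yes (Fin.all? λ x → Fin.all? λ y → adjK4 x y ∧ eqℤ₄ x y Bool.≟ false)

Shrikhande : FinGraph (ℤ₄ × ℤ₄)
Shrikhande .vertices = allℤ₄²
Shrikhande .eq       = eqPair
Shrikhande .adj      = adjShr
Shrikhande .nbrs x   = filterᵇ (adjShr x) allℤ₄²
Shrikhande .sift (x , y) g = trans (∑-grid _,_ (allFin 4) (allFin 4) (λ z → [ eqPair (x , y) z ]· g z))
  (sift-× K4 K4 x y (λ a b → g (a , b)))
Shrikhande .∑-adj x g = sym (∑-filter (adjShr x) allℤ₄² g)
Shrikhande .irreflexive (x₁ , x₂) (y₁ , y₂) = irr x₁ x₂ y₁ y₂
  where
  irr : ∀ x₁ x₂ y₁ y₂ → adjShr (x₁ , x₂) (y₁ , y₂) ∧ eqPair (x₁ , x₂) (y₁ , y₂) ≡ false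
  irr = from-yes (Fin.all? λ x₁ → Fin.all? λ x₂ → Fin.all? λ y₁ → Fin.all? λ y₂ →
    adjShr (x₁ , x₂) (y₁ , y₂) ∧ eqPair (x₁ , x₂) (y₁ , y₂) Bool.≟ false)

nbrsS : Vec (ℤ₄ × ℤ₄) m → List (Vec (ℤ₄ × ℤ₄) m)
nbrsS = nbrsVec (nbrs Shrikhande)

nbrsK : Vec ℤ₄ n → List (Vec ℤ₄ n)
nbrsK = nbrsVec (nbrs K4)

nbrsD : Vertex m n → List (Vertex m n)
nbrsD (u , w) = map (_, w) (nbrsS u) ++ map (u ,_) (nbrsK w)

∑-nbrsD : (u : Vec (ℤ₄ × ℤ₄) m) (w : Vec ℤ₄ n) (g : Vertex m n → ℕ) →
  ∑ (nbrsD (u , w)) g ≡ ∑[ u′ ∈ nbrsS u ] g (u′ , w) + ∑[ w′ ∈ nbrsK w ] g (u , w′)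
∑-nbrsD u w g = trans (∑-++ (map (_, w) (nbrsS u)) _ g)
  (cong₂ _+_ (∑-map (_, w) (nbrsS u) g) (∑-map (u ,_) (nbrsK w) g))

∑-adjD : (v : Vertex m n) (g : Vertex m n → ℕ) →
  ∑[ w ∈ allVertices m n ] [ adjD v w ]· g w ≡ ∑ (nbrsD v) g
∑-adjD {m} {n} (u , w) g = begin
  ∑[ v ∈ allVertices m n ] [ adjD (u , w) v ]· g v
    ≡⟨ ∑-grid _,_ (allVecs allℤ₄² m) (allVecs (allFin 4) n) _ ⟩
  _
    ≡⟨ ∑-adj-× (vecGraph Shrikhande m) (vecGraph K4 n) u w (λ u′ w′ → g (u′ , w′)) ⟩
  ∑[ u′ ∈ nbrsS u ] g (u′ , w) + ∑[ w′ ∈ nbrsK w ] g (u , w′)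
    ≡⟨ ∑-nbrsD u w g ⟨
  ∑ (nbrsD (u , w)) g ∎

isColor : Fin 2 → Fin 2 → ℕ
isColor j c = [ ⌊ c Fin.≟ j ⌋ ]· 1

nbrsOfColor-∑ : (col : Vertex m n → Fin 2) (v : Vertex m n) (j : Fin 2) →
  nbrsOfColor col v j ≡ ∑[ w ∈ nbrsD v ] isColor j (col w)
nbrsOfColor-∑ {m} {n} col v j = begin
  nbrsOfColor col v j
    ≡⟨ length-filter (λ w → adjD v w ∧ ⌊ col w Fin.≟ j ⌋) (allVertices m n) ⟩
  ∑[ w ∈ allVertices m n ] [ adjD v w ∧ ⌊ col w Fin.≟ j ⌋ ]· 1
    ≡⟨ ∑-cong (λ w → if-∧ (adjD v w)) (allVertices m n) ⟩
  ∑[ w ∈ allVertices m n ] [ adjD v w ]· isColor j (col w)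
    ≡⟨ ∑-adjD v (isColor j ∘ col) ⟩
  ∑[ w ∈ nbrsD v ] isColor j (col w) ∎

-- Serves surjectivity: one vertex with a neighbour of the other colour shows that both colours
-- occur.
nbrsOfColor-witness : (col : Vertex m n → Fin 2) (v : Vertex m n) (j : Fin 2) →
  nbrsOfColor col v j ≥ 1 → ∃ λ w → col w ≡ j
nbrsOfColor-witness {m} {n} col v j 1≤
  with filter-witness (λ w → adjD v w ∧ ⌊ col w Fin.≟ j ⌋) (allVertices m n) 1≤
... | w , eq with adjD v w | col w Fin.≟ j | eq
...   | true | yes col≡j | _ = w , col≡j

-- Deciding permutations, and sums over K₄ and 𝔽₄.

module _ (_≟_ : DecidableEquality A) where

  -- By cancellation, any occurrence of `x` in `ys` may be struck out, so the search never
  -- backtracks. Identities between explicit lists thereby become matters of evaluation.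
  permutation? : Decidable (_↭_ {A = A})
  permutation? []       []       = yes ↭-refl
  permutation? []       (y ∷ ys) = no (λ p → case ↭.↭-length p of λ ())
  permutation? (x ∷ xs) ys with any? (x ≟_) ys
  ... | no x∉ys = no (λ p → x∉ys (↭.∈-resp-↭ p (here refl)))
  ... | yes x∈ys with ∈-∃++ x∈ys
  ...   | as , bs , refl = map′
    (λ p → ↭-trans (prep x p) (↭-sym (↭.shift x as bs)))
    (λ p → ↭.drop-∷ (↭-trans p (↭.shift x as bs)))
    (permutation? xs (as ++ bs))

_↭?_ : Decidable (_↭_ {A = ℤ₄})
_↭?_ = permutation? Fin._≟_

-- In a complete graph the closed ball of any vertex is the whole vertex set.
∑-K4-ball : (x : ℤ₄) (g : ℤ₄ → ℕ) → g x + ∑ (nbrs K4 x) g ≡ ∑ (allFin 4) g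
∑-K4-ball x = ∑-↭ (ball x)
  where
  ball : ∀ x → x ∷ nbrs K4 x ↭ allFin 4
  ball = from-yes (Fin.all? λ x → (x ∷ nbrs K4 x) ↭? allFin 4)

-- Addition and multiplication by a generator ω in 𝔽₄ = {0, 1, ω, ω + 1}.
_⊕_ : ℤ₄ → ℤ₄ → ℤ₄
0F ⊕ y  = y
1F ⊕ 0F = 1F
1F ⊕ 1F = 0F
1F ⊕ 2F = 3F
1F ⊕ 3F = 2F
2F ⊕ 0F = 2F
2F ⊕ 1F = 3F
2F ⊕ 2F = 0F
2F ⊕ 3F = 1F
3F ⊕ 0F = 3F
3F ⊕ 1F = 2F
3F ⊕ 2F = 1F
3F ⊕ 3F = 0F

ω· : ℤ₄ → ℤ₄
ω· 0F = 0F
ω· 1F = 2F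
ω· 2F = 3F
ω· 3F = 1F

∑-⊕ˡ : (x : ℤ₄) (g : ℤ₄ → ℕ) → ∑[ y ∈ allFin 4 ] g (x ⊕ y) ≡ ∑ (allFin 4) g
∑-⊕ˡ x g = ∑-↭ (translation x) g
  where
  translation : ∀ x → map (x ⊕_) (allFin 4) ↭ allFin 4
  translation = from-yes (Fin.all? λ x → map (x ⊕_) (allFin 4) ↭? allFin 4)

∑-⊕ʳ : (y : ℤ₄) (g : ℤ₄ → ℕ) → ∑[ x ∈ allFin 4 ] g (x ⊕ y) ≡ ∑ (allFin 4) g
∑-⊕ʳ y g = ∑-↭ (translation y) g
  where
  translation : ∀ y → map (_⊕ y) (allFin 4) ↭ allFin 4
  translation = from-yes (Fin.all? λ y → map (_⊕ y) (allFin 4) ↭? allFin 4)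

-- Foldings of D(m,n) onto K₄ᵏ × ℤ₄, and the three basic blocks.

record Folding (m n k : ℕ) : Set where
  field
    fold   : Vertex m n → Vec ℤ₄ k × ℤ₄
    -- The neighbours of `v` hit every fibre over a neighbour of its first component, each point
    -- once, and miss the fibre of `v` itself. The second component of `fold v` does not enter.
    ∑-fold : ∀ v (g : Vec ℤ₄ k × ℤ₄ → ℕ) →
      ∑ (nbrsD v) (g ∘ fold) ≡ ∑[ p ∈ nbrsK (proj₁ (fold v)) ] ∑[ q ∈ allFin 4 ] g (p , q)

open Folding

emptyFolding : Folding 0 0 0
emptyFolding .fold   _         = [] , 0F
emptyFolding .∑-fold ([] , []) g = refl

foldedNbrs : Vec ℤ₄ k → List (Vec ℤ₄ k × ℤ₄)
foldedNbrs p = concatMap (λ p′ → map (p′ ,_) (allFin 4)) (nbrsK p)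

-- The form of `∑-fold` without weights, decidable at each of the 256 vertices of a block.
IsFolding : (Vertex m n → Vec ℤ₄ k × ℤ₄) → Vertex m n → Set
IsFolding f v = map f (nbrsD v) ↭ foldedNbrs (proj₁ (f v))

isFolding? : (f : Vertex m n → Vec ℤ₄ k × ℤ₄) (v : Vertex m n) → Dec (IsFolding f v)
isFolding? f v = permutation? (≡-dec (Vec.≡-dec Fin._≟_) Fin._≟_) _ _

mkFolding : (f : Vertex m n → Vec ℤ₄ k × ℤ₄) → (∀ v → IsFolding f v) → Folding m n k
mkFolding f isF .fold = f
mkFolding f isF .∑-fold v g = begin
  ∑ (nbrsD v) (g ∘ f)
    ≡⟨ ∑-map f (nbrsD v) g ⟨
  ∑ (map f (nbrsD v)) g
    ≡⟨ ∑-↭ (isF v) g ⟩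
  ∑ (foldedNbrs (proj₁ (f v))) g
    ≡⟨ ∑-grid _,_ (nbrsK (proj₁ (f v))) (allFin 4) g ⟩
  ∑[ p ∈ nbrsK (proj₁ (f v)) ] ∑[ q ∈ allFin 4 ] g (p , q) ∎

block₂₀ : Folding 2 0 1
block₂₀ = mkFolding f λ { ((x₁ , x₂) ∷ (y₁ , y₂) ∷ [] , []) → check x₁ x₂ y₁ y₂ }
  where
  -- (s , t) is the homomorphism ℤ₄² × ℤ₄² → ℤ₄² given by the identity on the first
  -- factor and (1,0) ↦ (1,2), (0,1) ↦ (2,3) on the second: the two connection sets
  -- are sent to disjoint sets whose union is ℤ₄² ∖ 2ℤ₄², so p is the class of (s , t)
  -- mod 2ℤ₄² and q its position in that class.
  f : Vertex 2 0 → Vec ℤ₄ 1 × ℤ₄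
  f ((x₁ , x₂) ∷ (y₁ , y₂) ∷ [] , []) =
    ((s % 2 + 2 * (t % 2)) mod 4 ∷ []) , (s / 2 + 2 * (t / 2)) mod 4
    where
    s t : ℕ
    s = (toℕ x₁ + toℕ y₁ + 2 * toℕ y₂) % 4
    t = (toℕ x₂ + 2 * toℕ y₁ + 3 * toℕ y₂) % 4
  check : ∀ x₁ x₂ y₁ y₂ → IsFolding f ((x₁ , x₂) ∷ (y₁ , y₂) ∷ [] , [])
  check = from-yes (Fin.all? λ x₁ → Fin.all? λ x₂ → Fin.all? λ y₁ → Fin.all? λ y₂ →
    isFolding? f ((x₁ , x₂) ∷ (y₁ , y₂) ∷ [] , []))

block₁₂ : Folding 1 2 1
block₁₂ = mkFolding f λ { ((x , y) ∷ [] , z ∷ t ∷ []) → check x y z t }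
  where
  -- The elements of ℤ₄² outside the Shrikhande connection set are the multiples of
  -- (1,2), (2,1) and (1,3).  With (a , b) = (x , y) + z (2,1) + t (1,3), p = 2a + b is
  -- the class modulo the subgroup generated by (1,2), and q = a.
  f : Vertex 1 2 → Vec ℤ₄ 1 × ℤ₄
  f ((x , y) ∷ [] , z ∷ t ∷ []) =
    ((2 * toℕ x + toℕ y + toℕ z + toℕ t) mod 4 ∷ []) , (toℕ x + 2 * toℕ z + toℕ t) mod 4
  check : ∀ x y z t → IsFolding f ((x , y) ∷ [] , z ∷ t ∷ [])
  check = from-yes (Fin.all? λ x → Fin.all? λ y → Fin.all? λ z → Fin.all? λ t →
    isFolding? f ((x , y) ∷ [] , z ∷ t ∷ []))

block₀₄ : Folding 0 4 1
block₀₄ = mkFolding f λ { ([] , x ∷ y ∷ z ∷ t ∷ []) → check x y z t }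
  where
  -- The columns (1 , 0), (1 , 1), (1 , ω), (1 , ω²) over 𝔽₄.
  f : Vertex 0 4 → Vec ℤ₄ 1 × ℤ₄
  f ([] , x ∷ y ∷ z ∷ t ∷ []) = (x ⊕ (y ⊕ (z ⊕ t)) ∷ []) , y ⊕ (ω· z ⊕ ω· (ω· t))
  check : ∀ x y z t → IsFolding f ([] , x ∷ y ∷ z ∷ t ∷ [])
  check = from-yes (Fin.all? λ x → Fin.all? λ y → Fin.all? λ z → Fin.all? λ t →
    isFolding? f ([] , x ∷ y ∷ z ∷ t ∷ []))

-- Products of foldings.

take-++ : (xs : Vec A m) (ys : Vec A n) → Vec.take m (xs Vec.++ ys) ≡ xs
take-++ {m = m} xs ys =
  Vec.++-injectiveˡ (Vec.take m (xs Vec.++ ys)) xs (Vec.take++drop≡id m (xs Vec.++ ys))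

drop-++ : (xs : Vec A m) (ys : Vec A n) → Vec.drop m (xs Vec.++ ys) ≡ ys
drop-++ {m = m} xs ys =
  Vec.++-injectiveʳ (Vec.take m (xs Vec.++ ys)) xs (Vec.take++drop≡id m (xs Vec.++ ys))

_⊞_ : Vertex m n → Vertex m′ n′ → Vertex (m + m′) (n + n′)
(u , w) ⊞ (u′ , w′) = u Vec.++ u′ , w Vec.++ w′

∑-nbrsD-⊞ : (v : Vertex m n) (v′ : Vertex m′ n′) (g : Vertex (m + m′) (n + n′) → ℕ) →
  ∑ (nbrsD (v ⊞ v′)) g ≡ ∑[ x ∈ nbrsD v ] g (x ⊞ v′) + ∑[ x ∈ nbrsD v′ ] g (v ⊞ x)
∑-nbrsD-⊞ (u , w) (u′ , w′) g = begin
  ∑ (nbrsD ((u , w) ⊞ (u′ , w′))) g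
    ≡⟨ ∑-nbrsD (u Vec.++ u′) (w Vec.++ w′) g ⟩
  ∑[ x ∈ nbrsS (u Vec.++ u′) ] g (x , w Vec.++ w′) + ∑[ x ∈ nbrsK (w Vec.++ w′) ] g (u Vec.++ u′ , x)
    ≡⟨ cong₂ _+_ (∑-nbrsVec-++ (nbrs Shrikhande) u u′ (λ x → g (x , w Vec.++ w′)))
                 (∑-nbrsVec-++ (nbrs K4) w w′ (λ x → g (u Vec.++ u′ , x))) ⟩
  ∑[ x ∈ nbrsS u ] g (x Vec.++ u′ , w Vec.++ w′) + ∑[ x ∈ nbrsS u′ ] g (u Vec.++ x , w Vec.++ w′) +
    (∑[ x ∈ nbrsK w ] g (u Vec.++ u′ , x Vec.++ w′) + ∑[ x ∈ nbrsK w′ ] g (u Vec.++ u′ , w Vec.++ x))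
    ≡⟨ interchange (∑ (nbrsS u) _) (∑ (nbrsS u′) _) (∑ (nbrsK w) _) (∑ (nbrsK w′) _) ⟩
  _
    ≡⟨ cong₂ _+_ (∑-nbrsD u w (λ x → g (x ⊞ (u′ , w′))))
                 (∑-nbrsD u′ w′ (λ x → g ((u , w) ⊞ x))) ⟨
  ∑[ x ∈ nbrsD (u , w) ] g (x ⊞ (u′ , w′)) + ∑[ x ∈ nbrsD (u′ , w′) ] g ((u , w) ⊞ x) ∎

combine : Vec ℤ₄ k × ℤ₄ → Vec ℤ₄ k′ × ℤ₄ → Vec ℤ₄ (k + k′) × ℤ₄
combine (p , q) (p′ , q′) = p Vec.++ p′ , q ⊕ q′

-- A neighbour changes only one of the two parts. The other part contributes a constant summand to
-- the second component, a translation that the sum over all of `ℤ₄` absorbs.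
_⊗_ : Folding m n k → Folding m′ n′ k′ → Folding (m + m′) (n + n′) (k + k′)
_⊗_ {m} {n} {k} {m′} {n′} {k′} F F′ = record
  { fold   = f
  -- Every vertex has the form `first v ⊞ second v`, so the identity is proved for `⊞` and
  -- transported along `join`.
  ; ∑-fold = λ v → subst P (join v) (∑-f (first v) (second v))
  }
  where
  first : Vertex (m + m′) (n + n′) → Vertex m n
  first (u , w) = Vec.take m u , Vec.take n w

  second : Vertex (m + m′) (n + n′) → Vertex m′ n′
  second (u , w) = Vec.drop m u , Vec.drop n w

  f : Vertex (m + m′) (n + n′) → Vec ℤ₄ (k + k′) × ℤ₄
  f v = combine (fold F (first v)) (fold F′ (second v))

  P : Vertex (m + m′) (n + n′) → Set
  P v = (g : Vec ℤ₄ (k + k′) × ℤ₄ → ℕ) →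
    ∑ (nbrsD v) (g ∘ f) ≡ ∑[ p ∈ nbrsK (proj₁ (f v)) ] ∑[ q ∈ allFin 4 ] g (p , q)

  join : ∀ v → first v ⊞ second v ≡ v
  join (u , w) = cong₂ _,_ (Vec.take++drop≡id m u) (Vec.take++drop≡id n w)

  f-⊞ : ∀ v v′ → f (v ⊞ v′) ≡ combine (fold F v) (fold F′ v′)
  f-⊞ (u , w) (u′ , w′) = cong₂ combine
    (cong (fold F) (cong₂ _,_ (take-++ u u′) (take-++ w w′)))
    (cong (fold F′) (cong₂ _,_ (drop-++ u u′) (drop-++ w w′)))

  ∑-f : ∀ v v′ → P (v ⊞ v′)
  ∑-f v v′ g = begin
    ∑ (nbrsD (v ⊞ v′)) (g ∘ f)
      ≡⟨ ∑-nbrsD-⊞ v v′ (g ∘ f) ⟩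
    ∑[ x ∈ nbrsD v ] g (f (x ⊞ v′)) + ∑[ x ∈ nbrsD v′ ] g (f (v ⊞ x))
      ≡⟨ cong₂ _+_ (∑-cong (λ x → cong g (f-⊞ x v′)) (nbrsD v))
                   (∑-cong (λ x → cong g (f-⊞ v x)) (nbrsD v′)) ⟩
    ∑[ x ∈ nbrsD v ] g (combine (fold F x) (p′ , q′)) + ∑[ x ∈ nbrsD v′ ] g (combine (p , q) (fold F′ x))
      ≡⟨ cong₂ _+_ (∑-fold F v (λ r → g (combine r (p′ , q′))))
                   (∑-fold F′ v′ (λ r → g (combine (p , q) r))) ⟩
    ∑[ x ∈ nbrsK p ] ∑[ y ∈ allFin 4 ] g (x Vec.++ p′ , y ⊕ q′) +
      ∑[ x ∈ nbrsK p′ ] ∑[ y ∈ allFin 4 ] g (p Vec.++ x , q ⊕ y)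
      ≡⟨ cong₂ _+_ (∑-cong (λ x → ∑-⊕ʳ q′ (λ y → g (x Vec.++ p′ , y))) (nbrsK p))
                   (∑-cong (λ x → ∑-⊕ˡ q (λ y → g (p Vec.++ x , y))) (nbrsK p′)) ⟩
    ∑[ x ∈ nbrsK p ] ∑[ y ∈ allFin 4 ] g (x Vec.++ p′ , y) +
      ∑[ x ∈ nbrsK p′ ] ∑[ y ∈ allFin 4 ] g (p Vec.++ x , y)
      ≡⟨ ∑-nbrsVec-++ (nbrs K4) p p′ (λ x → ∑[ y ∈ allFin 4 ] g (x , y)) ⟨
    ∑[ x ∈ nbrsK (p Vec.++ p′) ] ∑[ y ∈ allFin 4 ] g (x , y)
      ≡⟨ cong (λ r → ∑[ x ∈ nbrsK (proj₁ r) ] ∑[ y ∈ allFin 4 ] g (x , y)) (f-⊞ v v′) ⟨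
    ∑[ x ∈ nbrsK (proj₁ (f (v ⊞ v′))) ] ∑[ y ∈ allFin 4 ] g (x , y) ∎
    where
    p = proj₁ (fold F v)
    q = proj₂ (fold F v)
    p′ = proj₁ (fold F′ v′)
    q′ = proj₂ (fold F′ v′)

-- Shrikhande factors are used up two at a time. A single one left over needs two K₄ factors, which
-- exist because 2 + `n` is a positive multiple of 4. With `m * 2` and `k * 4`, both sides shed the
-- 4 of a block by computation.
folding : ∀ k m n → m * 2 + n ≡ k * 4 → Folding m n k
folding zero    zero          zero          _  = emptyFolding
folding (suc k) zero          _             refl = block₀₄ ⊗ folding k zero (k * 4) refl
folding (suc k) (suc zero)    (suc (suc n)) eq = block₁₂ ⊗ folding k zero n (+-cancelˡ-≡ 4 _ _ eq)
folding (suc k) (suc (suc m)) n             eq = block₂₀ ⊗ folding k m n (+-cancelˡ-≡ 4 _ _ eq)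

-- Labellings that are bijective on closed balls.

record BallColoring (m n l : ℕ) : Set where
  field
    color  : Vertex m n → Vec ℤ₄ l
    -- Equivalently, every label class is a 1-perfect code.
    ∑-ball : ∀ v (g : Vec ℤ₄ l → ℕ) →
      g (color v) + ∑ (nbrsD v) (g ∘ color) ≡ ∑ (allVecs (allFin 4) l) g

open BallColoring

pointColoring : BallColoring 0 0 0
pointColoring .color  _           = []
pointColoring .∑-ball ([] , []) g = refl

-- Varying `x` yields, together with the vertex itself, all labels with tail `h p`. The other
-- neighbours yield all labels with tail `h p′`, once for each neighbour `p′` of `p`. By the
-- property of `H`, these tails run once over all of `Vec ℤ₄ l`.
lift : BallColoring 0 k l → Folding m n k → BallColoring m (suc n) (suc l)
lift {k} {l} {m} {n} H F = record { color = col ; ∑-ball = ball }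
  where
  h : Vec ℤ₄ k → Vec ℤ₄ l
  h p = color H ([] , p)

  col : Vertex m (suc n) → Vec ℤ₄ (suc l)
  col (u , x ∷ w) = proj₂ (fold F (u , w)) ⊕ x ∷ h (proj₁ (fold F (u , w)))

  ball : ∀ v (g : Vec ℤ₄ (suc l) → ℕ) →
    g (col v) + ∑ (nbrsD v) (g ∘ col) ≡ ∑ (allVecs (allFin 4) (suc l)) g
  ball (u , x ∷ w) g = begin
    g (q ⊕ x ∷ h p) + ∑ (nbrsD (u , x ∷ w)) (g ∘ col)
      ≡⟨ cong (g (q ⊕ x ∷ h p) +_) (trans (∑-nbrsD u (x ∷ w) (g ∘ col))
           (cong (Su +_) (∑-nbrsVec-∷ (nbrs K4) x w _))) ⟩
    g (q ⊕ x ∷ h p) + (Su + (∑[ y ∈ nbrs K4 x ] g (q ⊕ y ∷ h p) + Sw))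
      ≡⟨ regroup (g (q ⊕ x ∷ h p)) Su _ Sw ⟩
    (g (q ⊕ x ∷ h p) + ∑[ y ∈ nbrs K4 x ] g (q ⊕ y ∷ h p)) + (Su + Sw)
      ≡⟨ cong₂ _+_ (trans (∑-K4-ball x (λ y → g (q ⊕ y ∷ h p))) (∑-⊕ˡ q (λ y → g (y ∷ h p))))
                   (sym (∑-nbrsD u w _)) ⟩
    total (h p) + ∑[ v ∈ nbrsD (u , w) ] G (fold F v)
      ≡⟨ cong (total (h p) +_) (∑-fold F (u , w) G) ⟩
    total (h p) + ∑[ p′ ∈ nbrsK p ] ∑[ y ∈ allFin 4 ] g (y ⊕ x ∷ h p′)
      ≡⟨ cong (total (h p) +_) (∑-cong (λ p′ → ∑-⊕ʳ x (λ y → g (y ∷ h p′))) (nbrsK p)) ⟩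
    total (h p) + ∑[ p′ ∈ nbrsK p ] total (h p′)
      ≡⟨ cong (total (h p) +_) (∑-nbrsD [] p (total ∘ color H)) ⟨
    total (h p) + ∑ (nbrsD ([] , p)) (total ∘ color H)
      ≡⟨ ∑-ball H ([] , p) total ⟩
    ∑[ s ∈ allVecs (allFin 4) l ] ∑[ y ∈ allFin 4 ] g (y ∷ s)
      ≡⟨ ∑-swap (allVecs (allFin 4) l) (allFin 4) (λ s y → g (y ∷ s)) ⟩
    ∑[ y ∈ allFin 4 ] ∑[ s ∈ allVecs (allFin 4) l ] g (y ∷ s)
      ≡⟨ ∑-grid _∷_ (allFin 4) (allVecs (allFin 4) l) g ⟨
    ∑ (allVecs (allFin 4) (suc l)) g ∎
    where
    p = proj₁ (fold F (u , w))
    q = proj₂ (fold F (u , w))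
    Su = ∑[ u′ ∈ nbrsS u ] g (col (u′ , x ∷ w))
    Sw = ∑[ w′ ∈ nbrsK w ] g (col (u , x ∷ w′))
    total : Vec ℤ₄ l → ℕ
    total s = ∑[ y ∈ allFin 4 ] g (y ∷ s)
    G : Vec ℤ₄ k × ℤ₄ → ℕ
    G (p′ , q′) = g (q′ ⊕ x ∷ h p′)
    regroup : ∀ a b c d → a + (b + (c + d)) ≡ (a + c) + (b + d)
    regroup = solve-∀

-- The length (4 ^ l ∸ 1) / 3 of the quaternary Hamming code with `l` check symbols, given by a
-- recursion that matches the construction.
size : ℕ → ℕ
size zero    = 0
size (suc l) = suc (size l * 4)

4^≡1+size*3 : ∀ l → 4 ^ l ≡ suc (size l * 3)
4^≡1+size*3 zero    = refl
4^≡1+size*3 (suc l) = trans (cong (4 *_) (4^≡1+size*3 l)) (expand (size l))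
  where
  expand : ∀ s → 4 * (1 + s * 3) ≡ 1 + (1 + s * 4) * 3
  expand = solve-∀

[4^∸1]/3≡size : ∀ l → (4 ^ l ∸ 1) / 3 ≡ size l
[4^∸1]/3≡size l = trans (cong (λ z → (z ∸ 1) / 3) (4^≡1+size*3 l)) (m*n/n≡m (size l) 3)

ballColoring : ∀ l m n → m * 2 + n ≡ size l → BallColoring m n l
ballColoring zero    zero zero    _  = pointColoring
-- `size (suc l)` is odd, so there is always a K₄ factor to set aside.
ballColoring (suc l) m    zero    eq =
  contradiction (trans (even m) (trans eq (odd (size l)))) (even≢odd m (2 * size l))
  where
  even : ∀ m → 2 * m ≡ m * 2 + 0
  even = solve-∀
  odd : ∀ s → 1 + s * 4 ≡ 1 + 2 * (2 * s)
  odd = solve-∀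
ballColoring (suc l) m    (suc n) eq =
  lift (ballColoring l 0 (size l) refl)
       (folding (size l) m n (suc-injective (trans (sym (+-suc (m * 2) n)) eq)))

-- Dividing the 4 ^ l labels into classes of sizes `b` and `c`.

apportion : ∀ x y {b c} → b + c ≡ x + y →
  ∃ λ b₁ → ∃ λ c₁ → ∃ λ b₂ → ∃ λ c₂ →
    b₁ + b₂ ≡ b × c₁ + c₂ ≡ c × b₁ + c₁ ≡ x × b₂ + c₂ ≡ y
apportion x y {b} {c} eq with ≤-total b x
-- The first part is filled from `b` as far as possible, then from `c`.
... | inj₁ b≤x = b , x ∸ b , 0 , y , +-identityʳ b , +-cancelˡ-≡ b _ _ rest , m+[n∸m]≡n b≤x , refl
  where
  rest : b + (x ∸ b + y) ≡ b + c
  rest = trans (sym (+-assoc b (x ∸ b) y)) (trans (cong (_+ y) (m+[n∸m]≡n b≤x)) (sym eq))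
... | inj₂ x≤b = x , 0 , b ∸ x , c , m+[n∸m]≡n x≤b , refl , +-identityʳ x , +-cancelˡ-≡ x _ _ rest
  where
  rest : x + (b ∸ x + c) ≡ x + y
  rest = trans (sym (+-assoc x (b ∸ x) c)) (trans (cong (_+ c) (m+[n∸m]≡n x≤b)) eq)

-- `κ` depends on the label and not on its position in the list, so the division follows the
-- structure of `allVecs` instead of cutting the list in two.
Splits : List A → ℕ → Set
Splits {A} xs M = ∀ b c → b + c ≡ M → ∃ λ (κ : A → Fin 2) →
  ∑ xs (isColor 0F ∘ κ) ≡ c × ∑ xs (isColor 1F ∘ κ) ≡ b

splits-rows : (xs : List A) → Splits xs M → ∀ k b c → b + c ≡ k * M →
  ∃ λ (κ : Fin k → A → Fin 2) →
    ∑[ i ∈ allFin k ] ∑ xs (isColor 0F ∘ κ i) ≡ c × ∑[ i ∈ allFin k ] ∑ xs (isColor 1F ∘ κ i) ≡ b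
splits-rows xs sp zero    zero zero _ = (λ ()) , refl , refl
splits-rows {A} {M} xs sp (suc k) b c eq
  with b₁ , c₁ , b₂ , c₂ , b-eq , c-eq , eq₁ , eq₂ ← apportion M (k * M) eq
  with κ₁ , κ₁-0 , κ₁-1 ← sp b₁ c₁ eq₁
  with κ₂ , κ₂-0 , κ₂-1 ← splits-rows xs sp k b₂ c₂ eq₂
  = κ , trans (row 0F κ₁-0 κ₂-0) c-eq , trans (row 1F κ₁-1 κ₂-1) b-eq
  where
  κ : Fin (suc k) → A → Fin 2
  κ zero    = κ₁
  κ (suc i) = κ₂ i
  row : ∀ j {s t} → ∑ xs (isColor j ∘ κ₁) ≡ s → ∑[ i ∈ allFin k ] ∑ xs (isColor j ∘ κ₂ i) ≡ t →
    ∑[ i ∈ allFin (suc k) ] ∑ xs (isColor j ∘ κ i) ≡ s + t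
  -- The tail of `allFin (suc k)` is a tabulation of `suc`; both sums are brought to the same
  -- tabulation.
  row j refl refl = cong (λ zs → ∑ xs (isColor j ∘ κ₁) + sum zs)
    (trans (map-tabulate suc _) (sym (map-tabulate {n = k} (λ i → i) _)))

splits-cons : ∀ l → Splits (allVecs (allFin 4) l) M → Splits (allVecs (allFin 4) (suc l)) (4 * M)
splits-cons l sp b c eq = uncons κ , trans (rows 0F) κ-0 , trans (rows 1F) κ-1
  where
  split = splits-rows (allVecs (allFin 4) l) sp 4 b c eq
  κ = proj₁ split
  κ-0 = proj₁ (proj₂ split)
  κ-1 = proj₂ (proj₂ split)
  uncons : (ℤ₄ → Vec ℤ₄ l → Fin 2) → Vec ℤ₄ (suc l) → Fin 2
  uncons κ (x ∷ v) = κ x v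
  rows : ∀ j → ∑ (allVecs (allFin 4) (suc l)) (isColor j ∘ uncons κ)
    ≡ ∑[ x ∈ allFin 4 ] ∑ (allVecs (allFin 4) l) (isColor j ∘ κ x)
  rows j = ∑-grid _∷_ (allFin 4) (allVecs (allFin 4) l) (isColor j ∘ uncons κ)

splits-allVecs : ∀ l → Splits (allVecs (allFin 4) l) (4 ^ l)
splits-allVecs (suc l) = splits-cons l (splits-allVecs l)
splits-allVecs zero zero    (suc zero) _ = (λ _ → 0F) , refl , refl
splits-allVecs zero (suc zero) zero    _ = (λ _ → 1F) , refl , refl

-- The perfect colouring obtained by merging labels into two colours.

theorem3 : (b c l : ℕ) → b ≥ 1 → c ≥ 1 → l ≥ 1 → gcd b c ≡ 1 → b + c ≡ 4 ^ l →
    (m n : ℕ) → 2 * m + n ≡ (4 ^ l ∸ 1) / 3 →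
    Σ (Vertex m n → Fin 2) λ col →
    (∃ λ v → col v ≡ zero) × (∃ λ v → col v ≡ suc zero) ×
    (∀ v → col v ≡ zero →
    (nbrsOfColor col v zero ≡ c ∸ 1) × (nbrsOfColor col v (suc zero) ≡ b)) ×
    (∀ v → col v ≡ suc zero →
    (nbrsOfColor col v zero ≡ c) × (nbrsOfColor col v (suc zero) ≡ b ∸ 1))
theorem3 b c l b≥1 c≥1 _ _ b+c≡4^l m n eq
  with κ , κ-0 , κ-1 ← splits-allVecs l b c b+c≡4^l
  = col , witness₀ , witness₁ , from₀ , from₁
  where
  P : BallColoring m n l
  P = ballColoring l m n (trans (cong (_+ n) (*-comm m 2)) (trans eq ([4^∸1]/3≡size l)))

  col : Vertex m n → Fin 2
  col = κ ∘ color P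

  -- The closed ball of `v` carries each label once, hence `t` vertices of colour `j`. Leaving out
  -- `v` itself costs one exactly when `i` is `j`.
  count : ∀ v i j {t} → ∑ (allVecs (allFin 4) l) (isColor j ∘ κ) ≡ t → col v ≡ i →
    nbrsOfColor col v j ≡ t ∸ isColor j i
  count v i j refl refl = begin
    nbrsOfColor col v j
      ≡⟨ nbrsOfColor-∑ col v j ⟩
    ∑ (nbrsD v) (isColor j ∘ col)
      ≡⟨ m+n∸m≡n (isColor j (col v)) _ ⟨
    isColor j (col v) + ∑ (nbrsD v) (isColor j ∘ col) ∸ isColor j (col v)
      ≡⟨ cong (_∸ isColor j (col v)) (∑-ball P v (isColor j ∘ κ)) ⟩
    ∑ (allVecs (allFin 4) l) (isColor j ∘ κ) ∸ isColor j (col v) ∎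

  from₀ : ∀ v → col v ≡ 0F → nbrsOfColor col v 0F ≡ c ∸ 1 × nbrsOfColor col v 1F ≡ b
  from₀ v v≡0 = count v 0F 0F κ-0 v≡0 , count v 0F 1F κ-1 v≡0

  from₁ : ∀ v → col v ≡ 1F → nbrsOfColor col v 0F ≡ c × nbrsOfColor col v 1F ≡ b ∸ 1
  from₁ v v≡1 = count v 1F 0F κ-0 v≡1 , count v 1F 1F κ-1 v≡1

  origin : Vertex m n
  origin = Vec.replicate m (0F , 0F) , Vec.replicate n 0F

  witness₀ : ∃ λ v → col v ≡ 0F
  witness₀ with col origin in eq₀
  ... | 0F = origin , eq₀
  -- An origin of colour 2 has `c` neighbours of colour 1, and `c` is positive.
  ... | 1F = nbrsOfColor-witness col origin 0F (≤-trans c≥1 (≤-reflexive (sym (proj₁ (from₁ origin eq₀)))))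

  witness₁ : ∃ λ v → col v ≡ 1F
  witness₁ with col origin in eq₀
  ... | 0F = nbrsOfColor-witness col origin 1F (≤-trans b≥1 (≤-reflexive (sym (proj₂ (from₀ origin eq₀)))))
  ... | 1F = origin , eq₀
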